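{- Let $\lambda\in\mathbb{R}$, let $r,n\ge1$ be integers and let $0\le k\le nr$. Then \[ S_\lambda^{(r,r)}(n,k)=\frac{(-1)^k}{k!}\sum_{p=0}^{k}(-1)^p\binom{k}{p}\big((p)_r\big)_{n,\lambda}. \]
   Context: Notation: $(x)_0=1$, $(x)_m=x(x-1)\cdots(x-m+1)$ for $m\ge1$; the generalized (degenerate) falling factorial is $(y)_{0,\lambda}=1$, $(y)_{n,\lambda}=y(y-\lambda)\cdots(y-(n-1)\lambda)$ for $n\ge1$. Let $D=\frac{d}{dx}$ and let $x$ also denote multiplication by $x$. The numbers $S_\lambda^{(r,r)}(n,k)$, $0\le k\le nr$ (generalized degenerate $(r,r)$-Stirling numbers of the second kind) are defined by the operator identity \[ \prod_{j=0}^{n-1}\Big(x^{r}D^{r}-j\lambda\Big)=\sum_{k=0}^{nr}S_\lambda^{(r,r)}(n,k)\,x^{k}D^{k}. \] -}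

module Defs where

open import Algebra.Apartness.Bundles using (HeytingField; HeytingCommutativeRing)
open import Algebra.Bundles using (CommutativeRing)
open import Data.Fin.Base using (Fin; toℕ)
open import Data.List.Base using (List; []; _∷_; map)
open import Data.Nat.Base as ℕ using (ℕ; zero; suc; NonZero; _!)
open import Data.Nat.Properties using (_!≢0)
open import Data.Product.Base using (proj₁)
import Data.Vec.Functional as Vector
import Function.Endo.Propositional as Endo
open import Function.Base using (id; _∘_)
open import Level using (_⊔_)

module Stirling {c ℓ} (R : CommutativeRing c ℓ) where

  open CommutativeRing R
  open import Algebra.Properties.Semiring.Mult semiring using (_×_)

  -- (y)_{m,ƛ} = y (y - ƛ) ⋯ (y - (m-1)ƛ); the ordinary (y)_m is the case ƛ = 1.
  degenerateFalling : Carrier → Carrier → ℕ → Carrier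
  degenerateFalling ƛ y zero    = 1#
  degenerateFalling ƛ y (suc m) = degenerateFalling ƛ y m * (y - m × ƛ)

  falling : Carrier → ℕ → Carrier
  falling = degenerateFalling 1#

  -- Coefficients in order of increasing degree.  Trailing zeros are allowed,
  -- so polynomials are compared by _≈ₚ_ and not by equality of lists.
  Poly : Set c
  Poly = List Carrier

  coeff : Poly → ℕ → Carrier
  coeff []      _       = 0#
  coeff (a ∷ f) zero    = a
  coeff (a ∷ f) (suc i) = coeff f i

  infix 4 _≈ₚ_
  _≈ₚ_ : Poly → Poly → Set ℓ
  f ≈ₚ g = ∀ i → coeff f i ≈ coeff g i

  infixl 6 _+ₚ_
  _+ₚ_ : Poly → Poly → Poly
  []      +ₚ g       = g
  (a ∷ f) +ₚ []      = a ∷ f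
  (a ∷ f) +ₚ (b ∷ g) = a + b ∷ f +ₚ g

  infixr 7 _·ₚ_
  _·ₚ_ : Carrier → Poly → Poly
  a ·ₚ f = map (a *_) f

  Operator : Set c
  Operator = Poly → Poly

  open Endo Poly public using () renaming (_^_ to _^ₒ_)

  infix 4 _≈ₒ_
  _≈ₒ_ : Operator → Operator → Set (c ⊔ ℓ)
  A ≈ₒ B = ∀ f → A f ≈ₚ B f

  infixr 7 _·ₒ_
  _·ₒ_ : Carrier → Operator → Operator
  (a ·ₒ A) f = a ·ₚ A f

  infixl 6 _-ₒ_
  _-ₒ_ : Operator → Operator → Operator
  (A -ₒ B) f = A f +ₚ (- 1#) ·ₚ B f

  sumₒ : ∀ {m} → (Fin m → Operator) → Operator
  sumₒ A f = Vector.foldr _+ₚ_ [] (λ i → A i f)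

  -- The leftmost factor is the one with j = 0.
  prodₒ : ∀ {m} → (Fin m → Operator) → Operator
  prodₒ = Vector.foldr (λ A B → A ∘ B) id

  X : Operator
  X f = 0# ∷ f

  -- (a + x f)′ = f + x f′
  D : Operator
  D []      = []
  D (a ∷ f) = f +ₚ X (D f)

  -- The identity
  --   ∏_{j<n} (x^r D^r - jƛ) = ∑_{k≤nr} S k x^k D^k
  -- of operators on polynomials, which defines S k = S_ƛ^{(r,r)}(n,k).
  IsDegenerateStirling₂ : (ƛ : Carrier) (r n : ℕ) →
                          (Fin (suc (n ℕ.* r)) → Carrier) → Set (c ⊔ ℓ)
  IsDegenerateStirling₂ ƛ r n S =
    prodₒ {n} (λ j → ((X ^ₒ r) ∘ (D ^ₒ r)) -ₒ (toℕ j × ƛ) ·ₒ id)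
      ≈ₒ
    sumₒ (λ k → S k ·ₒ ((X ^ₒ toℕ k) ∘ (D ^ₒ toℕ k)))

module Field {c ℓ₁ ℓ₂} (F : HeytingField c ℓ₁ ℓ₂) where

  open HeytingField F public using (heytingCommutativeRing; _#_; #⇒invertible)
  open HeytingCommutativeRing heytingCommutativeRing public using (commutativeRing)
  open CommutativeRing commutativeRing public
    using (Carrier; _≈_; _+_; _*_; -_; _-_; 0#; 1#; semiring; +-monoid)
  open import Algebra.Properties.Semiring.Mult semiring public using (_×_)
  open import Algebra.Properties.Semiring.Exp semiring public using (_^_)
  open import Algebra.Properties.Monoid.Sum +-monoid public using (sum)
  open Stirling commutativeRing public

  CharacteristicZero : Set ℓ₂
  CharacteristicZero = ∀ m → .{{NonZero m}} → m × 1# # 0#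

  -- #⇒invertible yields the inverse of k! - 0.
  1/[_!] : ℕ → CharacteristicZero → Carrier
  1/[ k !] char0 = proj₁ (#⇒invertible (char0 (k !) {{k !≢0}}))

{-# OPTIONS --safe #-}
-- Every x^k D^k is diagonal in the monomial basis, with eigenvalue (p)_k at
-- x^p.  So the operator identity says exactly that
--   ((p)_r)_{n,ƛ} = ∑_m S_m (p)_m   for every p.
-- The alternating binomial sums ∑_p (-1)^p C(k,p) a_p are the k-th iterated
-- differences (of a_p - a_{p+1}) at 0; applied to (p)_m they give (-1)^k k!
-- if m = k and 0 otherwise, which isolates S_k.
module Submission where

open import Algebra.Apartness.Bundles using (HeytingField)
open import Algebra.Bundles using (CommutativeRing)
open import Data.Fin.Base using (Fin; zero; suc; toℕ; fromℕ; inject₁; punchIn)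
open import Data.Fin.Properties using (toℕ-inject₁; toℕ-fromℕ; toℕ-injective; punchInᵢ≢i)
open import Data.List.Base using ([]; _∷_)
open import Data.Nat.Base as ℕ using (ℕ; zero; suc; _≤_; _!)
open import Data.Nat.Combinatorics using (_C_; k>n⇒nCk≡0; nCk+nC[k+1]≡[n+1]C[k+1])
open import Data.Nat.Properties using (_!≢0; n<1+n)
open import Data.Product.Base using (proj₁; proj₂)
open import Data.Vec.Functional using (removeAt)
open import Function.Base using (id; _∘_)
open import Level using (_⊔_)
open import Relation.Binary.PropositionalEquality.Core as ≡ using (_≡_; _≢_)
open import Relation.Nullary.Negation using (contradiction)
open import Defs

module StirlingProperties {c ℓ} (R : CommutativeRing c ℓ) where

  open CommutativeRing R hiding (zero)
  open Stirling R
  open import Algebra.Properties.Semiring.Mult semiring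
  open import Algebra.Properties.Semiring.Exp semiring using (_^_)
  open import Algebra.Properties.Semiring.Sum semiring
  open import Algebra.Properties.Monoid.Sum *-monoid using () renaming
    (sum to product; sum-cong-≋ to product-cong; sum-init-last to product-init-last)
  open import Algebra.Properties.Ring ring
  open import Algebra.Properties.AbelianGroup +-abelianGroup
    using (⁻¹-involutive; ⁻¹-∙-comm; ε⁻¹≈ε)
  open import Algebra.Solver.Ring.NaturalCoefficients.Default commutativeSemiring
    using (solve; _:=_; _:+_; _:*_; con)
  open import Relation.Binary.Reasoning.Setoid setoid

  -- Degenerate and ordinary falling factorials.

  degenerateFalling≈product : ∀ ƛ y m →
    degenerateFalling ƛ y m ≈ product {m} (λ j → y - toℕ j × ƛ)
  degenerateFalling≈product ƛ y zero    = refl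
  degenerateFalling≈product ƛ y (suc m) = begin
    degenerateFalling ƛ y m * factor m
      ≈⟨ *-congʳ (degenerateFalling≈product ƛ y m) ⟩
    product {m} (factor ∘ toℕ) * factor m
      ≈⟨ *-cong (product-cong {m} (λ j → factor-cong (≡.sym (toℕ-inject₁ j))))
                (factor-cong (≡.sym (toℕ-fromℕ m))) ⟩
    product {m} (factor ∘ toℕ ∘ inject₁) * factor (toℕ (fromℕ m))
      ≈⟨ product-init-last {m} (factor ∘ toℕ) ⟨
    product {suc m} (factor ∘ toℕ) ∎
    where
    factor : ℕ → Carrier
    factor j = y - j × ƛ
    factor-cong : ∀ {i j} → i ≡ j → factor i ≈ factor j
    factor-cong i≡j = reflexive (≡.cong factor i≡j)

  degenerateFalling-cong : ∀ ƛ {y z} → y ≈ z → ∀ m →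
    degenerateFalling ƛ y m ≈ degenerateFalling ƛ z m
  degenerateFalling-cong ƛ y≈z zero    = refl
  degenerateFalling-cong ƛ y≈z (suc m) =
    *-cong (degenerateFalling-cong ƛ y≈z m) (+-congʳ y≈z)

  -- The definition multiplies by the last factor; passing through the product form splits off the
  -- first one instead, and the remaining factors are those of the base point shifted by `ƛ`.
  degenerateFalling-suc : ∀ ƛ y m →
    degenerateFalling ƛ y (suc m) ≈ y * degenerateFalling ƛ (y - ƛ) m
  degenerateFalling-suc ƛ y m = begin
    degenerateFalling ƛ y (suc m)
      ≈⟨ degenerateFalling≈product ƛ y (suc m) ⟩
    (y - 0#) * product {m} (λ j → y - (ƛ + toℕ j × ƛ))
      ≈⟨ *-cong (trans (+-congˡ ε⁻¹≈ε) (+-identityʳ y))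
                (product-cong {m} λ j →
                  trans (+-congˡ (sym (⁻¹-∙-comm ƛ (toℕ j × ƛ)))) (sym (+-assoc _ _ _))) ⟩
    y * product {m} (λ j → (y - ƛ) - toℕ j × ƛ)
      ≈⟨ *-congˡ (degenerateFalling≈product ƛ (y - ƛ) m) ⟨
    y * degenerateFalling ƛ (y - ƛ) m ∎

  falling-0 : ∀ m → falling 0# (suc m) ≈ 0#
  falling-0 m = trans (degenerateFalling-suc 1# 0# m) (zeroˡ _)

  falling-1+ : ∀ y m → falling (1# + y) (suc m) ≈ (1# + y) * falling y m
  falling-1+ y m = trans (degenerateFalling-suc 1# (1# + y) m)
    (*-congˡ (degenerateFalling-cong 1# 1+y-1≈y m))
    where
    1+y-1≈y : 1# + y - 1# ≈ y
    1+y-1≈y = begin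
      1# + y - 1#    ≈⟨ solve 3 (λ a b n → a :+ b :+ n := b :+ (a :+ n)) refl 1# y (- 1#) ⟩
      y + (1# - 1#)  ≈⟨ +-congˡ (-‿inverseʳ 1#) ⟩
      y + 0#         ≈⟨ +-identityʳ y ⟩
      y              ∎

  -- Both terms contain (y)_m: the first is (y)_m (y - m), the second (1 + y) (y)_m, and y - m - (1
  -- + y) = -(m + 1).
  falling-difference : ∀ y m →
    falling y (suc m) - falling (1# + y) (suc m) ≈ - (suc m × 1#) * falling y m
  falling-difference y m = begin
    f * (y - μ) - falling (1# + y) (suc m)
      ≈⟨ +-congˡ (-‿cong (falling-1+ y m)) ⟩
    f * (y - μ) - (1# + y) * f
      ≈⟨ +-congˡ (-‿distribˡ-* (1# + y) f) ⟩
    f * (y - μ) + - (1# + y) * f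
      ≈⟨ +-congˡ (*-congʳ (⁻¹-∙-comm 1# y)) ⟨
    f * (y - μ) + (- 1# + - y) * f
      -- The solver works over semirings, so the negatives enter as independent atoms and y - y is
      -- only collected here, then cancelled in the next step.
      ≈⟨ solve 5 (λ f y n o z → f :* (y :+ n) :+ (o :+ z) :* f
                             := (o :+ n) :* f :+ (y :+ z) :* f)
                 refl f y (- μ) (- 1#) (- y) ⟩
    (- 1# + - μ) * f + (y - y) * f
      ≈⟨ +-cong (*-congʳ (⁻¹-∙-comm 1# μ))
                (trans (*-congʳ (-‿inverseʳ y)) (zeroˡ f)) ⟩
    - (1# + μ) * f + 0#
      ≈⟨ +-identityʳ _ ⟩
    - (1# + μ) * f ∎
    where
    f = falling y m
    μ = m × 1#

  -- Coefficients, and operators diagonal in the monomial basis.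

  coeff-+ₚ : ∀ f g i → coeff (f +ₚ g) i ≈ coeff f i + coeff g i
  coeff-+ₚ []      g       i       = sym (+-identityˡ _)
  coeff-+ₚ (a ∷ f) []      i       = sym (+-identityʳ _)
  coeff-+ₚ (a ∷ f) (b ∷ g) zero    = refl
  coeff-+ₚ (a ∷ f) (b ∷ g) (suc i) = coeff-+ₚ f g i

  coeff-·ₚ : ∀ a f i → coeff (a ·ₚ f) i ≈ a * coeff f i
  coeff-·ₚ a []      i       = sym (zeroʳ a)
  coeff-·ₚ a (b ∷ f) zero    = refl
  coeff-·ₚ a (b ∷ f) (suc i) = coeff-·ₚ a f i

  coeff-D : ∀ f i → coeff (D f) i ≈ (suc i × 1#) * coeff f (suc i)
  coeff-D []      i       = sym (zeroʳ _)
  coeff-D (a ∷ f) zero    = begin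
    coeff (f +ₚ X (D f)) zero  ≈⟨ coeff-+ₚ f (X (D f)) zero ⟩
    coeff f zero + 0#          ≈⟨ +-identityʳ _ ⟩
    coeff f zero               ≈⟨ *-identityˡ _ ⟨
    1# * coeff f zero          ≈⟨ *-congʳ (+-identityʳ 1#) ⟨
    (1# + 0#) * coeff f zero   ∎
  coeff-D (a ∷ f) (suc i) = begin
    coeff (f +ₚ X (D f)) (suc i)
      ≈⟨ coeff-+ₚ f (X (D f)) (suc i) ⟩
    coeff f (suc i) + coeff (D f) i
      -- The summand `f` in (a + x f)' = f + x f' supplies the extra 1 that turns the multiplier i +
      -- 1 into i + 2.
      ≈⟨ +-cong (sym (*-identityˡ _)) (coeff-D f i) ⟩
    1# * coeff f (suc i) + (suc i × 1#) * coeff f (suc i)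
      ≈⟨ distribʳ _ _ _ ⟨
    (suc (suc i) × 1#) * coeff f (suc i) ∎

  -- Formulated through coefficients because lists with trailing zeros represent the same
  -- polynomial. The record wrapper lets `A` and `e` be inferred by unification.
  record Diagonal (A : Operator) (e : ℕ → Carrier) : Set (c ⊔ ℓ) where
    constructor diagonal
    field coeff-diagonal : ∀ f i → coeff (A f) i ≈ e i * coeff f i
  open Diagonal

  Diagonal-id : Diagonal id (λ _ → 1#)
  Diagonal-id .coeff-diagonal f i = sym (*-identityˡ _)

  Diagonal-∘ : ∀ {A B d e} → Diagonal A d → Diagonal B e →
               Diagonal (A ∘ B) (λ i → d i * e i)
  Diagonal-∘ {A} {B} (diagonal A-diag) (diagonal B-diag) .coeff-diagonal f i =
    trans (A-diag (B f) i) (trans (*-congˡ (B-diag f i)) (sym (*-assoc _ _ _)))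

  Diagonal-·ₒ : ∀ {A d} a → Diagonal A d → Diagonal (a ·ₒ A) (λ i → a * d i)
  Diagonal-·ₒ {A} a (diagonal A-diag) .coeff-diagonal f i =
    trans (coeff-·ₚ a (A f) i) (trans (*-congˡ (A-diag f i)) (sym (*-assoc _ _ _)))

  Diagonal--ₒ : ∀ {A B d e} → Diagonal A d → Diagonal B e →
                Diagonal (A -ₒ B) (λ i → d i - e i)
  Diagonal--ₒ {A} {B} {d} {e} (diagonal A-diag) (diagonal B-diag) .coeff-diagonal f i = begin
    coeff (A f +ₚ (- 1#) ·ₚ B f) i
      ≈⟨ coeff-+ₚ (A f) _ i ⟩
    coeff (A f) i + coeff ((- 1#) ·ₚ B f) i
      ≈⟨ +-cong (A-diag f i) (begin
           coeff ((- 1#) ·ₚ B f) i     ≈⟨ coeff-·ₚ (- 1#) (B f) i ⟩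
           - 1# * coeff (B f) i        ≈⟨ *-congˡ (B-diag f i) ⟩
           - 1# * (e i * coeff f i)    ≈⟨ *-assoc _ _ _ ⟨
           - 1# * e i * coeff f i      ≈⟨ *-congʳ (-1*x≈-x _) ⟩
           - e i * coeff f i           ∎) ⟩
    d i * coeff f i + - e i * coeff f i
      ≈⟨ distribʳ _ _ _ ⟨
    (d i - e i) * coeff f i ∎

  Diagonal-sumₒ : ∀ {m A} {d : Fin m → ℕ → Carrier} → (∀ k → Diagonal (A k) (d k)) →
                  Diagonal (sumₒ A) (λ i → sum (λ k → d k i))
  Diagonal-sumₒ {zero}      A-diag .coeff-diagonal f i = sym (zeroˡ _)
  Diagonal-sumₒ {suc m} {A} A-diag .coeff-diagonal f i =
    trans (coeff-+ₚ (A zero f) _ i)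
      (trans (+-cong (A-diag zero .coeff-diagonal f i)
                     (Diagonal-sumₒ (A-diag ∘ suc) .coeff-diagonal f i))
        (sym (distribʳ _ _ _)))

  Diagonal-prodₒ : ∀ {m A} {d : Fin m → ℕ → Carrier} → (∀ k → Diagonal (A k) (d k)) →
                   Diagonal (prodₒ A) (λ i → product (λ k → d k i))
  Diagonal-prodₒ {zero}  A-diag = Diagonal-id
  Diagonal-prodₒ {suc m} A-diag = Diagonal-∘ (A-diag zero) (Diagonal-prodₒ (A-diag ∘ suc))

  -- Eigenvalues of x^k D^k, and the operator identity read on monomials.

  D^-comm : ∀ k f → D ((D ^ₒ k) f) ≡ (D ^ₒ k) (D f)
  D^-comm zero    f = ≡.refl
  D^-comm (suc k) f = ≡.cong D (D^-comm k f)

  -- Induction on x^(k+1) D^(k+1) = x (x^k D^k) D: the inner derivative lowers degree i + 1 to i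
  -- with factor i + 1, the outer x restores the degree, and (i + 1) (i)_k = (i + 1)_(k+1).
  Diagonal-x^kD^k : ∀ k → Diagonal ((X ^ₒ k) ∘ (D ^ₒ k)) (λ i → falling (i × 1#) k)
  Diagonal-x^kD^k zero    = Diagonal-id
  -- The outer x makes the constant coefficient 0, in agreement with (0)_(k+1) = 0.
  Diagonal-x^kD^k (suc k) .coeff-diagonal f zero    = sym (trans (*-congʳ (falling-0 k)) (zeroˡ _))
  Diagonal-x^kD^k (suc k) .coeff-diagonal f (suc i) = begin
    coeff ((X ^ₒ k) (D ((D ^ₒ k) f))) i
      -- The iterate places the new derivative outermost; moved innermost, it leaves x^k D^k acting
      -- on `D f`, where the induction hypothesis applies.
      ≡⟨ ≡.cong (λ g → coeff ((X ^ₒ k) g) i) (D^-comm k f) ⟩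
    coeff ((X ^ₒ k) ((D ^ₒ k) (D f))) i
      ≈⟨ Diagonal-x^kD^k k .coeff-diagonal (D f) i ⟩
    falling (i × 1#) k * coeff (D f) i
      ≈⟨ *-congˡ (coeff-D f i) ⟩
    falling (i × 1#) k * ((suc i × 1#) * coeff f (suc i))
      ≈⟨ solve 3 (λ a b c → a :* (b :* c) := b :* a :* c) refl _ _ _ ⟩
    (suc i × 1#) * falling (i × 1#) k * coeff f (suc i)
      ≈⟨ *-congʳ (falling-1+ (i × 1#) k) ⟨
    falling (suc i × 1#) (suc k) * coeff f (suc i) ∎

  coeff-monomial : ∀ i → coeff ((X ^ₒ i) (1# ∷ [])) i ≈ 1#
  coeff-monomial zero    = refl
  coeff-monomial (suc i) = coeff-monomial i

  -- Both operators are tested on x^i, whose coefficient in degree i is 1.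
  eigenvalue-unique : ∀ {A B d e} → Diagonal A d → Diagonal B e → A ≈ₒ B → ∀ i → d i ≈ e i
  eigenvalue-unique {A} {B} {d} {e} A-diag B-diag A≈B i = begin
    d i                 ≈⟨ at-monomial A-diag ⟨
    coeff (A x^i) i     ≈⟨ A≈B x^i i ⟩
    coeff (B x^i) i     ≈⟨ at-monomial B-diag ⟩
    e i                 ∎
    where
    x^i = (X ^ₒ i) (1# ∷ [])
    at-monomial : ∀ {O h} → Diagonal O h → coeff (O x^i) i ≈ h i
    at-monomial (diagonal O-diag) =
      trans (O-diag x^i i) (trans (*-congˡ (coeff-monomial i)) (*-identityʳ _))

  degenerateFalling-expansion : ∀ ƛ r n S → IsDegenerateStirling₂ ƛ r n S → ∀ p →
    degenerateFalling ƛ (falling (p × 1#) r) n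
      ≈ sum (λ k → S k * falling (p × 1#) (toℕ k))
  degenerateFalling-expansion ƛ r n S S-stirling p = begin
    degenerateFalling ƛ y n
      ≈⟨ degenerateFalling≈product ƛ y n ⟩
    product {n} (λ j → y - toℕ j × ƛ)
      -- The inserted 1 is the eigenvalue of `id`, so that each factor has the form delivered by
      -- `Diagonal-·ₒ`.
      ≈⟨ product-cong {n} (λ j → +-congˡ (-‿cong (sym (*-identityʳ _)))) ⟩
    product {n} (λ j → y - (toℕ j × ƛ) * 1#)
      ≈⟨ eigenvalue-unique
           (Diagonal-prodₒ {n} λ j →
             Diagonal--ₒ (Diagonal-x^kD^k r) (Diagonal-·ₒ (toℕ j × ƛ) Diagonal-id))
           (Diagonal-sumₒ λ k → Diagonal-·ₒ (S k) (Diagonal-x^kD^k (toℕ k)))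
           S-stirling p ⟩
    sum (λ k → S k * falling (p × 1#) (toℕ k)) ∎
    where y = falling (p × 1#) r

  -- Alternating binomial sums as iterated differences.

  alternatingTerm : (ℕ → Carrier) → ℕ → ℕ → Carrier
  alternatingTerm a b p = (- 1#) ^ p * (b × 1#) * a p

  alternatingSum : ℕ → (ℕ → Carrier) → Carrier
  alternatingSum k a = sum {suc k} (λ p → alternatingTerm a (k C toℕ p) (toℕ p))

  signedBinomial : ℕ → ℕ → Carrier
  signedBinomial k p = (- 1#) ^ p * ((k C p) × 1#)

  alternatingSum-cong : ∀ k a b → (∀ p → a p ≈ b p) →
                        alternatingSum k a ≈ alternatingSum k b
  alternatingSum-cong k a b a≈b =
    sum-cong-≋ {suc k} (λ p → *-congˡ {x = signedBinomial k (toℕ p)} (a≈b (toℕ p)))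

  alternatingSum-scale : ∀ k s a → alternatingSum k (λ p → s * a p) ≈ s * alternatingSum k a
  alternatingSum-scale k s a = begin
    alternatingSum k (λ p → s * a p)
      ≈⟨ sum-cong-≋ {suc k} (λ p → solve 3 (λ w s a → w :* (s :* a) := s :* (w :* a))
                                         refl (signedBinomial k (toℕ p)) s (a (toℕ p))) ⟩
    sum {suc k} (λ p → s * alternatingTerm a (k C toℕ p) (toℕ p))
      ≈⟨ *-distribˡ-sum {suc k} s (λ p → alternatingTerm a (k C toℕ p) (toℕ p)) ⟨
    s * alternatingSum k a ∎

  alternatingSum-sum : ∀ k {n} (a : Fin n → ℕ → Carrier) →
    alternatingSum k (λ p → sum (λ m → a m p)) ≈ sum (λ m → alternatingSum k (a m))
  alternatingSum-sum k a =
    trans (sum-cong-≋ {suc k} (λ p →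
            *-distribˡ-sum (signedBinomial k (toℕ p)) (λ m → a m (toℕ p))))
          (∑-comm {suc k} (λ p m → signedBinomial k (toℕ p) * a m (toℕ p)))

  alternatingTerm-0 : ∀ a p → alternatingTerm a 0 p ≈ 0#
  alternatingTerm-0 a p = trans (*-congʳ (zeroʳ _)) (zeroˡ _)

  -- Prepares for Pascal's rule: the binomial coefficient is an argument separate from the index, so
  -- it can be split while p stays fixed.
  alternatingTerm-+ : ∀ a b c p →
    alternatingTerm a (b ℕ.+ c) p ≈ alternatingTerm a b p + alternatingTerm a c p
  alternatingTerm-+ a b c p = begin
    (- 1#) ^ p * ((b ℕ.+ c) × 1#) * a p
      ≈⟨ *-congʳ (*-congˡ (×-homo-+ 1# b c)) ⟩
    (- 1#) ^ p * (b × 1# + c × 1#) * a p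
      ≈⟨ solve 4 (λ s b c a → s :* (b :+ c) :* a := s :* b :* a :+ s :* c :* a) refl _ _ _ _ ⟩
    alternatingTerm a b p + alternatingTerm a c p ∎

  -- Passing from p to p + 1 flips the sign, so two neighbouring terms with the same coefficient
  -- merge into one difference.
  alternatingTerm-difference : ∀ a b p →
    alternatingTerm a b p + alternatingTerm a b (suc p)
      ≈ alternatingTerm (λ q → a q - a (suc q)) b p
  alternatingTerm-difference a b p = begin
    (- 1#) ^ p * (b × 1#) * a p + (- 1# * (- 1#) ^ p) * (b × 1#) * a (suc p)
      ≈⟨ solve 5 (λ s b x o y → s :* b :* x :+ o :* s :* b :* y := s :* b :* (x :+ o :* y))
                 refl _ _ _ (- 1#) _ ⟩
    (- 1#) ^ p * (b × 1#) * (a p + - 1# * a (suc p))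
      ≈⟨ *-congˡ (+-congˡ (-1*x≈-x _)) ⟩
    (- 1#) ^ p * (b × 1#) * (a p - a (suc p)) ∎

  -- The additional term p = k + 1 carries C(k, k+1) = 0. The longer range is the one that occurs in
  -- the sum for k + 1.
  alternatingSum-extend : ∀ k a →
    sum {suc (suc k)} (λ p → alternatingTerm a (k C toℕ p) (toℕ p)) ≈ alternatingSum k a
  alternatingSum-extend k a = begin
    sum {suc (suc k)} (t ∘ toℕ)
      ≈⟨ sum-init-last {suc k} (t ∘ toℕ) ⟩
    sum {suc k} (t ∘ toℕ ∘ inject₁) + t (toℕ (fromℕ (suc k)))
      ≈⟨ +-cong (sum-cong-≋ {suc k} (λ p → reflexive (≡.cong t (toℕ-inject₁ p))))
                (reflexive (≡.cong t (toℕ-fromℕ (suc k)))) ⟩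
    alternatingSum k a + t (suc k)
      ≡⟨ ≡.cong (λ b → alternatingSum k a + alternatingTerm a b (suc k)) (k>n⇒nCk≡0 (n<1+n k)) ⟩
    alternatingSum k a + alternatingTerm a 0 (suc k)
      ≈⟨ +-congˡ (alternatingTerm-0 a (suc k)) ⟩
    alternatingSum k a + 0#
      ≈⟨ +-identityʳ _ ⟩
    alternatingSum k a ∎
    where
    t : ℕ → Carrier
    t p = alternatingTerm a (k C p) p

  -- Pascal's rule splits every term after the first. The parts with C(k, p+1) join the first term
  -- to give the sum for k; the parts with C(k, p) are its shifted copy, and the two sums are paired
  -- term by term.
  alternatingSum-suc : ∀ k a →
    alternatingSum (suc k) a ≈ alternatingSum k (λ p → a p - a (suc p))
  alternatingSum-suc k a = begin
    t₀ + sum {suc k} (λ p → alternatingTerm a (suc k C suc (toℕ p)) (suc (toℕ p)))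
      ≈⟨ +-congˡ (sum-cong-≋ {suc k} λ p → trans
           (reflexive (≡.cong (λ b → alternatingTerm a b (suc (toℕ p)))
             (≡.sym (nCk+nC[k+1]≡[n+1]C[k+1] k (toℕ p)))))
           (alternatingTerm-+ a (k C toℕ p) (k C suc (toℕ p)) (suc (toℕ p)))) ⟩
    t₀ + sum {suc k} (λ p → u p + v p)
      ≈⟨ +-congˡ (∑-distrib-+ {suc k} u v) ⟩
    t₀ + (sum u + sum v)
      ≈⟨ solve 3 (λ t u v → t :+ (u :+ v) := (t :+ v) :+ u) refl t₀ (sum u) (sum v) ⟩
    (t₀ + sum v) + sum u
      -- The coefficient 1 in `t₀` is the common value of C(k+1, 0) and C(k, 0), so `t₀` serves as
      -- the first term of the sum for k.
      ≈⟨ +-congʳ (alternatingSum-extend k a) ⟩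
    alternatingSum k a + sum u
      ≈⟨ ∑-distrib-+ {suc k} (λ p → alternatingTerm a (k C toℕ p) (toℕ p)) u ⟨
    sum {suc k} (λ p → alternatingTerm a (k C toℕ p) (toℕ p) + u p)
      ≈⟨ sum-cong-≋ {suc k} (λ p → alternatingTerm-difference a (k C toℕ p) (toℕ p)) ⟩
    alternatingSum k (λ p → a p - a (suc p)) ∎
    where
    t₀ = alternatingTerm a 1 0
    u v : Fin (suc k) → Carrier
    u p = alternatingTerm a (k C toℕ p) (suc (toℕ p))
    v p = alternatingTerm a (k C suc (toℕ p)) (suc (toℕ p))

  alternatingSum-0 : ∀ a → alternatingSum 0 a ≈ a 0
  alternatingSum-0 a = solve 1 (λ x → con 1 :* (con 1 :+ con 0) :* x :+ con 0 := x) refl (a 0)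

  -- Alternating sums of falling factorials.

  ℕfalling : ℕ → ℕ → Carrier
  ℕfalling m p = falling (p × 1#) m

  alternatingSum-falling-suc : ∀ k m →
    alternatingSum (suc k) (ℕfalling (suc m))
      ≈ - (suc m × 1#) * alternatingSum k (ℕfalling m)
  alternatingSum-falling-suc k m = begin
    alternatingSum (suc k) (ℕfalling (suc m))
      ≈⟨ alternatingSum-suc k (ℕfalling (suc m)) ⟩
    alternatingSum k (λ p → ℕfalling (suc m) p - ℕfalling (suc m) (suc p))
      ≈⟨ alternatingSum-cong k _ _ (λ p → falling-difference (p × 1#) m) ⟩
    alternatingSum k (λ p → - (suc m × 1#) * ℕfalling m p)
      ≈⟨ alternatingSum-scale k (- (suc m × 1#)) (ℕfalling m) ⟩
    - (suc m × 1#) * alternatingSum k (ℕfalling m) ∎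

  -- Each difference lowers both indices by one. If k runs out first, what remains is a falling
  -- factorial of positive length at 0; if m does, the differences of a constant remain. Both
  -- vanish.
  alternatingSum-falling-≢ : ∀ k m → m ≢ k → alternatingSum k (ℕfalling m) ≈ 0#
  alternatingSum-falling-≢ zero    zero    m≢k = contradiction ≡.refl m≢k
  alternatingSum-falling-≢ zero    (suc m) m≢k =
    trans (alternatingSum-0 (ℕfalling (suc m))) (falling-0 m)
  alternatingSum-falling-≢ (suc k) zero    m≢k = begin
    alternatingSum (suc k) (λ _ → 1#)
      ≈⟨ alternatingSum-suc k (λ _ → 1#) ⟩
    alternatingSum k (λ _ → 1# - 1#)
      -- Zero is written as a product so that a factor 0 can be pulled out of the whole sum.
      ≈⟨ alternatingSum-cong k _ _ (λ _ → trans (-‿inverseʳ 1#) (sym (zeroˡ 0#))) ⟩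
    alternatingSum k (λ _ → 0# * 0#)
      ≈⟨ alternatingSum-scale k 0# (λ _ → 0#) ⟩
    0# * alternatingSum k (λ _ → 0#)
      ≈⟨ zeroˡ _ ⟩
    0# ∎
  alternatingSum-falling-≢ (suc k) (suc m) m≢k =
    trans (alternatingSum-falling-suc k m)
      (trans (*-congˡ (alternatingSum-falling-≢ k m (m≢k ∘ ≡.cong suc))) (zeroʳ _))

  -- The successive differences contribute the factors -k, ..., -2, -1, and the empty falling
  -- factorial 1 is left.
  alternatingSum-falling-≡ : ∀ k →
    alternatingSum k (ℕfalling k) ≈ (- 1#) ^ k * ((k !) × 1#)
  alternatingSum-falling-≡ zero    =
    trans (alternatingSum-0 (ℕfalling 0)) (solve 0 (con 1 := con 1 :* (con 1 :+ con 0)) refl)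
  alternatingSum-falling-≡ (suc k) = begin
    alternatingSum (suc k) (ℕfalling (suc k))
      ≈⟨ alternatingSum-falling-suc k k ⟩
    - (suc k × 1#) * alternatingSum k (ℕfalling k)
      ≈⟨ *-cong (sym (-1*x≈-x _)) (alternatingSum-falling-≡ k) ⟩
    (- 1# * (suc k × 1#)) * ((- 1#) ^ k * ((k !) × 1#))
      ≈⟨ solve 4 (λ o n s f → (o :* n) :* (s :* f) := (o :* s) :* (n :* f)) refl (- 1#) _ _ _ ⟩
    (- 1#) ^ suc k * ((suc k × 1#) * ((k !) × 1#))
      ≈⟨ *-congˡ (×1-homo-* (suc k) (k !)) ⟨
    (- 1#) ^ suc k * ((suc k !) × 1#) ∎

  -- Isolating a single Stirling number.

  sum-single : ∀ {n} (t : Fin n → Carrier) k → (∀ m → m ≢ k → t m ≈ 0#) → sum t ≈ t k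
  sum-single {suc n} t k t≈0 = begin
    sum t                       ≈⟨ sum-remove {n} {k} t ⟩
    t k + sum (removeAt t k)    ≈⟨ +-congˡ (sum-cong-≋ {n} λ m → t≈0 _ (punchInᵢ≢i k m)) ⟩
    t k + sum {n} (λ _ → 0#)    ≈⟨ +-congˡ (sum-replicate-zero n) ⟩
    t k + 0#                    ≈⟨ +-identityʳ _ ⟩
    t k                         ∎

  -- After expansion in falling factorials and exchange of the two sums, the coefficient of S_m is
  -- the alternating sum of (p)_m, which vanishes unless m = k.
  alternatingSum-degenerateFalling : ∀ ƛ r n S → IsDegenerateStirling₂ ƛ r n S → ∀ k →
    alternatingSum (toℕ k) (λ p → degenerateFalling ƛ (falling (p × 1#) r) n)
      ≈ S k * ((- 1#) ^ toℕ k * ((toℕ k !) × 1#))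
  alternatingSum-degenerateFalling ƛ r n S S-stirling k = begin
    alternatingSum (toℕ k) (λ p → degenerateFalling ƛ (falling (p × 1#) r) n)
      ≈⟨ alternatingSum-cong (toℕ k) _ _ (degenerateFalling-expansion ƛ r n S S-stirling) ⟩
    alternatingSum (toℕ k) (λ p → sum (λ m → S m * ℕfalling (toℕ m) p))
      ≈⟨ alternatingSum-sum (toℕ k) (λ m p → S m * ℕfalling (toℕ m) p) ⟩
    sum (λ m → alternatingSum (toℕ k) (λ p → S m * ℕfalling (toℕ m) p))
      ≈⟨ sum-cong-≋ (λ m → alternatingSum-scale (toℕ k) (S m) (ℕfalling (toℕ m))) ⟩
    sum (λ m → S m * alternatingSum (toℕ k) (ℕfalling (toℕ m)))
      ≈⟨ sum-single _ k (λ m m≢k → trans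
           (*-congˡ {x = S m} (alternatingSum-falling-≢ (toℕ k) (toℕ m) (m≢k ∘ toℕ-injective)))
           (zeroʳ (S m))) ⟩
    S k * alternatingSum (toℕ k) (ℕfalling (toℕ k))
      ≈⟨ *-congˡ (alternatingSum-falling-≡ (toℕ k)) ⟩
    S k * ((- 1#) ^ toℕ k * ((toℕ k !) × 1#)) ∎

  -1^k*-1^k≈1 : ∀ k → (- 1#) ^ k * (- 1#) ^ k ≈ 1#
  -1^k*-1^k≈1 zero    = *-identityʳ 1#
  -1^k*-1^k≈1 (suc k) = begin
    (- 1# * s) * (- 1# * s)    ≈⟨ solve 2 (λ o s → (o :* s) :* (o :* s) := (o :* o) :* (s :* s)) refl (- 1#) s ⟩
    (- 1# * - 1#) * (s * s)    ≈⟨ *-cong (trans (-1*x≈-x (- 1#)) (⁻¹-involutive 1#)) (-1^k*-1^k≈1 k) ⟩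
    1# * 1#                    ≈⟨ *-identityʳ 1# ⟩
    1#                         ∎
    where s = (- 1#) ^ k

  -- Since (-1)^k is its own inverse, the factor (-1)^k f is undone by (-1)^k i; in the application
  -- f is k! and i its inverse.
  isolate : ∀ k {i f x y} → i * f ≈ 1# → x ≈ y * ((- 1#) ^ k * f) → y ≈ ((- 1#) ^ k * i) * x
  isolate k {i} {f} {x} {y} if≈1 x≈ysf = begin
    y                            ≈⟨ *-identityʳ y ⟨
    y * 1#                       ≈⟨ *-congˡ (*-identityʳ 1#) ⟨
    y * (1# * 1#)                ≈⟨ *-congˡ (*-cong (-1^k*-1^k≈1 k) if≈1) ⟨
    y * ((s * s) * (i * f))      ≈⟨ solve 4 (λ y s i f → y :* ((s :* s) :* (i :* f))
                                                      := (s :* i) :* (y :* (s :* f))) refl y s i f ⟩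
    (s * i) * (y * (s * f))      ≈⟨ *-congˡ x≈ysf ⟨
    (s * i) * x                  ∎
    where s = (- 1#) ^ k

theorem5 : ∀ {c ℓ₁ ℓ₂} (F : HeytingField c ℓ₁ ℓ₂) →
    let open Field F in
    (char0 : CharacteristicZero) →
    (ƛ : Carrier) (r n : ℕ) → 1 ≤ r → 1 ≤ n →
    (S : Fin (suc (n ℕ.* r)) → Carrier) → IsDegenerateStirling₂ ƛ r n S →
    (k : Fin (suc (n ℕ.* r))) →
    S k ≈ ((- 1#) ^ toℕ k * 1/[ toℕ k !] char0)
    * sum {suc (toℕ k)} (λ p →
    (- 1#) ^ toℕ p * ((toℕ k C toℕ p) × 1#)
    * degenerateFalling ƛ (falling (toℕ p × 1#) r) n)
theorem5 F char0 ƛ r n _ _ S S-stirling k =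
  isolate (toℕ k) 1/k!*k!≈1 (alternatingSum-degenerateFalling ƛ r n S S-stirling k)
  where
  open Field F
  open CommutativeRing commutativeRing using (trans; sym; *-congˡ; +-congˡ; +-identityʳ; +-abelianGroup)
  open StirlingProperties commutativeRing
  open import Algebra.Properties.AbelianGroup +-abelianGroup using (ε⁻¹≈ε)

  1/k!*k!≈1 : 1/[ toℕ k !] char0 * ((toℕ k !) × 1#) ≈ 1#
  1/k!*k!≈1 = trans
    -- Apartness from 0 provides an inverse of k! - 0, so k! is first rewritten in that form.
    (*-congˡ (sym (trans (+-congˡ ε⁻¹≈ε) (+-identityʳ _))))
    (proj₁ (proj₂ (#⇒invertible (char0 (toℕ k !) {{toℕ k !≢0}}))))
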